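{- Let $k$ and $n$ be two positive integers such that $1 \leq k < 10n-1$ and suppose that $\frac{k}{10n-1} = 0.\overline{a_1 \dots a_l}$, where $l$ is the length of the period of the decimal expansion $0.\overline{a_1 \dots a_l}$. For any $i \in \{1, \dots, l\}$ let $\tilde{q}_i, \tilde{r}_i$ be the nonnegative integers such that $$10^i \cdot k = \tilde{q}_i (10n-1) + \tilde{r}_i, \qquad 0 \leq \tilde{r}_i < 10n-1.$$ Then, for any $i \in \{1, \dots, l\}$: (1) $u(\tilde{q}_i) = a_i$; (2) $u(\tilde{q}_i) = u(\tilde{r}_i)$.
   Context: $\mathbf{N}$ denotes the set of nonnegative integers. The map $u : \mathbf{N} \to \{0, \dots, 9\}$ takes any nonnegative integer, represented in base $10$, to its rightmost digit (for example $u(127) = 7$); that is, $u(d)$ is the remainder of the Euclidean division of $d$ by $10$. The notation $0.\overline{a_1 \dots a_l}$ denotes the purely periodic decimal expansion with digits $a_1, \dots, a_l \in \{0, \dots, 9\}$ repeated indefinitely in this order. -}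

module Defs where

open import Data.Fin using (Fin; toℕ)
open import Data.Integer using (+_)
open import Data.Nat using (ℕ; zero; suc; _+_; _*_; _∸_; _^_; _≤_; NonZero; >-nonZero)
open import Data.Nat.DivMod using (_mod_)
open import Data.Nat.Properties using (m≤n⇒m≤o+n; m≤m+n; m^n≢0)
open import Data.Product using (_×_; ∃-syntax)
open import Data.Rational using (ℚ; 0ℚ; Positive; _/_; _-_; ∣_∣)
  renaming (_+_ to _+ℚ_; _<_ to _<ℚ_)
open import Relation.Binary.PropositionalEquality using (_≡_)

Digit : Set
Digit = Fin 10

u : ℕ → Digit
u d = d mod 10

-- A sequence d stands for the expansion 0.d₀d₁d₂…, so d j is the digit of
-- weight 10^-(j+1).
truncation : (ℕ → Digit) → ℕ → ℚ
truncation d zero    = 0ℚ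
truncation d (suc m) =
  truncation d m +ℚ _/_ (+ toℕ (d m)) (10 ^ suc m) {{m^n≢0 10 (suc m)}}

-- x = 0.d₀d₁d₂…, the sum of an infinite series.  As x is rational, ordinary
-- convergence of the truncations to x can be expressed within ℚ.
_HasExpansion_ : ℚ → (ℕ → Digit) → Set
x HasExpansion d =
  ∀ (ε : ℚ) → Positive ε →
    ∃[ N ] (∀ m → N ≤ m → ∣ truncation d m - x ∣ <ℚ ε)

-- The block a₁…a_l repeated indefinitely; a₁ is the value of a at zero.
repeat : ∀ {l} .{{_ : NonZero l}} → (Fin l → Digit) → ℕ → Digit
repeat {l} a j = a (j mod l)

IsPeriod : (ℕ → Digit) → ℕ → Set
IsPeriod d p = 1 ≤ p × (∀ j → d (j + p) ≡ d j)

-- The length of the period is the least period, so that 0.\overline{33} does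
-- not count as having period length 2.
IsPeriodLength : (ℕ → Digit) → ℕ → Set
IsPeriodLength d l = IsPeriod d l × (∀ p → IsPeriod d p → l ≤ p)

10n∸1≢0 : ∀ n .{{_ : NonZero n}} → NonZero (10 * n ∸ 1)
10n∸1≢0 (suc n) = >-nonZero (m≤n⇒m≤o+n n (m≤m+n 1 _))

{-# OPTIONS --safe #-}
-- Put D = 10n − 1.  Part (2) is the congruence D ≡ −1 (mod 10) applied to
-- 10^i k = q D + r.  For part (1), let T m be the integer with decimal digits
-- d₀…d₍ₘ₋₁₎.  The partial sums of an expansion satisfy
-- T m / 10^m ≤ x ≤ (T m + 1) / 10^m, since a violation at m would persist as a
-- fixed gap between x and all later partial sums.  The upper bound is strict
-- because D is coprime to 10 and D ∤ k, so T i is the quotient q of 10^i k by D,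
-- and the last digit of T i is a_i.
module Submission where

open import Defs
open import Algebra.Properties.AbelianGroup using (xyx⁻¹≈y; ⁻¹-anti-homo‿-)
open import Data.Fin using (Fin; toℕ)
open import Data.Fin.Properties using (toℕ<n; toℕ-fromℕ<; toℕ-injective)
open import Data.Integer using (+_)
import Data.Integer as ℤ
import Data.Integer.Properties as ℤ
open import Data.Nat
  using (ℕ; zero; suc; _+_; _*_; _∸_; _^_; _≤_; _<_; NonZero)
open import Data.Nat.Divisibility using (_∣_; divides; ∣⇒≤; ∣m+n∣m⇒∣n; ∣n⇒∣m*n; m∣m*n)
open import Data.Nat.DivMod using (_%_; _mod_; m%n<n; m<n⇒m%n≡m; [m+kn]%n≡m%n)
open import Data.Nat.Properties
open import Data.Nat.Tactic.RingSolver using (solve-∀)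
open import Data.Product using (_×_; ∃-syntax; _,_; proj₁; proj₂)
open import Data.Rational using (ℚ; 0ℚ; _/_; _-_; ∣_∣)
  renaming (_+_ to _+ℚ_; _<_ to _<ℚ_; _≤_ to _≤ℚ_)
import Data.Rational.Properties as ℚ
open import Data.Rational.Unnormalised using (mkℚᵘ; *≡*)
import Data.Rational.Unnormalised.Properties as ℚᵘ
open import Data.Sum using (inj₁; inj₂)
open import Relation.Binary.PropositionalEquality
  using (_≡_; refl; sym; trans; cong; cong₂; subst; subst₂; module ≡-Reasoning)
open import Relation.Nullary using (¬_)

-- Fractions of natural numbers as rationals

-- `_/_` reduces to lowest terms, so the sum is computed in the unnormalised rationals, where it is
-- the cross formula, and carried back by injectivity of `toℚᵘ`.
/-+-/ : ∀ a b c d .{{_ : NonZero b}} .{{_ : NonZero d}} →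
  (+ a / b) +ℚ (+ c / d) ≡ (+ (a * d + c * b) / (b * d)) {{m*n≢0 b d}}
/-+-/ a b@(suc b′) c d@(suc d′) = ℚ.toℚᵘ-injective
  (ℚᵘ.≃-trans (ℚ.toℚᵘ-homo-+ (+ a / b) (+ c / d))
  (ℚᵘ.≃-trans (ℚᵘ.+-cong (ℚ.toℚᵘ-fromℚᵘ (mkℚᵘ (+ a) b′)) (ℚ.toℚᵘ-fromℚᵘ (mkℚᵘ (+ c) d′)))
  (ℚᵘ.≃-trans (*≡* (cong (ℤ._* (+ (b * d))) numerators))
  (ℚᵘ.≃-sym (ℚ.toℚᵘ-fromℚᵘ (mkℚᵘ (+ (a * d + c * b)) (d′ + b′ * suc d′)))))))
  where
  numerators : (+ a ℤ.* + d) ℤ.+ (+ c ℤ.* + b) ≡ + (a * d + c * b)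
  numerators = trans (cong₂ ℤ._+_ (sym (ℤ.pos-* a d)) (sym (ℤ.pos-* c b)))
                     (sym (ℤ.pos-+ (a * d) (c * b)))

/-cong-* : ∀ a b c d .{{_ : NonZero b}} .{{_ : NonZero d}} →
  a * d ≡ c * b → + a / b ≡ + c / d
/-cong-* a (suc b) c (suc d) eq = ℚ.fromℚᵘ-cong {mkℚᵘ (+ a) b} {mkℚᵘ (+ c) d}
  (*≡* (trans (sym (ℤ.pos-* a (suc d))) (trans (cong +_ eq) (ℤ.pos-* c (suc b)))))

/-cancel-< : ∀ a b c d .{{_ : NonZero b}} .{{_ : NonZero d}} →
  (+ a / b) <ℚ (+ c / d) → a * d < c * b
/-cancel-< a (suc b) c (suc d) lt = ℤ.drop‿+<+
  (subst₂ ℤ._<_ (sym (ℤ.pos-* a (suc d))) (sym (ℤ.pos-* c (suc b))) (ℚᵘ.drop-*<*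
    (ℚᵘ.<-respˡ-≃ (ℚ.toℚᵘ-fromℚᵘ (mkℚᵘ (+ a) b))
    (ℚᵘ.<-respʳ-≃ (ℚ.toℚᵘ-fromℚᵘ (mkℚᵘ (+ c) d))
    (ℚ.toℚᵘ-mono-< lt)))))

p≤∣p∣ : ∀ p → p ≤ℚ ∣ p ∣
p≤∣p∣ p with ℚ.≤-total 0ℚ p
... | inj₁ 0≤p = ℚ.≤-reflexive (sym (ℚ.0≤p⇒∣p∣≡p 0≤p))
... | inj₂ p≤0 = ℚ.≤-trans p≤0 (ℚ.0≤∣p∣ p)

∣p-q∣≡∣q-p∣ : ∀ p q → ∣ p - q ∣ ≡ ∣ q - p ∣
∣p-q∣≡∣q-p∣ p q = trans (sym (ℚ.∣-p∣≡∣p∣ (p - q))) (cong ∣_∣ (⁻¹-anti-homo‿- ℚ.+-0-abelianGroup p q))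

∣p-q∣<ε⇒p<q+ε : ∀ p q {ε} → ∣ p - q ∣ <ℚ ε → p <ℚ q +ℚ ε
∣p-q∣<ε⇒p<q+ε p q {ε} lt = subst (_<ℚ q +ℚ ε)
  (trans (sym (ℚ.+-assoc q p _)) (xyx⁻¹≈y ℚ.+-0-abelianGroup q p))
  (ℚ.+-monoʳ-< q (ℚ.≤-<-trans (p≤∣p∣ (p - q)) lt))

-- Clearing denominators retains one side of the absolute value; swapping the two fractions gives
-- the other side.
∣/-/∣<1/⇒< : ∀ a b c d e .{{_ : NonZero b}} .{{_ : NonZero d}} .{{_ : NonZero e}} →
  ∣ (+ a / b) - (+ c / d) ∣ <ℚ (+ 1 / e) → a * d * e < (c * e + d) * b
∣/-/∣<1/⇒< a b c d e lt =
  subst₂ _<_ (sym (*-assoc a d e)) (cong (λ t → (c * e + t) * b) (*-identityˡ d))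
    (/-cancel-< a b (c * e + 1 * d) (d * e)
      (subst ((+ a / b) <ℚ_) (/-+-/ c d 1 e)
        (∣p-q∣<ε⇒p<q+ε (+ a / b) (+ c / d) lt)))
  where
  instance
    d*e≢0 : NonZero (d * e)
    d*e≢0 = m*n≢0 d e

-- Integer prefixes of a digit sequence

prefix : (ℕ → Digit) → ℕ → ℕ
prefix d zero    = 0
prefix d (suc m) = prefix d m * 10 + toℕ (d m)

truncation≡prefix/10^m : ∀ d m → truncation d m ≡ (+ prefix d m / (10 ^ m)) {{m^n≢0 10 m}}
truncation≡prefix/10^m d zero    = refl
truncation≡prefix/10^m d (suc m) = begin
  truncation d m +ℚ (+ e / P′)   ≡⟨ cong (_+ℚ (+ e / P′)) (truncation≡prefix/10^m d m) ⟩
  (+ T / P) +ℚ (+ e / P′)        ≡⟨ /-+-/ T P e P′ ⟩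
  + (T * P′ + e * P) / (P * P′)  ≡⟨ /-cong-* (T * P′ + e * P) (P * P′) (T * 10 + e) P′ (identity T e P) ⟩
  + (T * 10 + e) / P′            ∎
  where
  open ≡-Reasoning
  T P P′ e : ℕ
  T  = prefix d m
  P  = 10 ^ m
  P′ = 10 ^ suc m
  e  = toℕ (d m)
  instance
    P≢0 : NonZero P
    P≢0 = m^n≢0 10 m
    P′≢0 : NonZero P′
    P′≢0 = m^n≢0 10 (suc m)
    PP′≢0 : NonZero (P * P′)
    PP′≢0 = m*n≢0 P P′
  identity : ∀ T e P → (T * (10 * P) + e * P) * (10 * P) ≡ (T * 10 + e) * (P * (10 * P))
  identity = solve-∀

-- Appending a digit multiplies the prefix by 10 and adds something nonnegative. Together with
-- `prefix-upper`, this nests the intervals from `T m / 10^m` to `(T m + 1) / 10^m`.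
prefix-lower : ∀ d j m → 10 ^ j * prefix d m ≤ prefix d (j + m)
prefix-lower d zero    m = ≤-reflexive (*-identityˡ _)
prefix-lower d (suc j) m = begin
  10 * 10 ^ j * prefix d m                  ≡⟨ identity (10 ^ j) (prefix d m) ⟩
  10 ^ j * prefix d m * 10                  ≤⟨ *-monoˡ-≤ 10 (prefix-lower d j m) ⟩
  prefix d (j + m) * 10                     ≤⟨ m≤m+n _ _ ⟩
  prefix d (j + m) * 10 + toℕ (d (j + m))   ∎
  where
  open ≤-Reasoning
  identity : ∀ x y → 10 * x * y ≡ x * y * 10
  identity = solve-∀

-- A digit is at most 9, so one more than the extended prefix is at most 10 times one more than the
-- old prefix; the `suc` on both sides makes the induction close.
prefix-upper : ∀ d j m → suc (prefix d (j + m)) ≤ 10 ^ j * suc (prefix d m)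
prefix-upper d zero    m = ≤-reflexive (sym (*-identityˡ _))
prefix-upper d (suc j) m = begin
  suc (T * 10 + toℕ (d (j + m)))     ≡⟨ +-suc (T * 10) _ ⟨
  T * 10 + suc (toℕ (d (j + m)))     ≤⟨ +-monoʳ-≤ (T * 10) (toℕ<n (d (j + m))) ⟩
  T * 10 + 10                        ≡⟨ +-comm (T * 10) 10 ⟩
  suc T * 10                         ≤⟨ *-monoˡ-≤ 10 (prefix-upper d j m) ⟩
  10 ^ j * suc (prefix d m) * 10     ≡⟨ identity (10 ^ j) (suc (prefix d m)) ⟩
  10 * 10 ^ j * suc (prefix d m)     ∎
  where
  open ≤-Reasoning
  T : ℕ
  T = prefix d (j + m)
  identity : ∀ x y → x * y * 10 ≡ 10 * x * y
  identity = solve-∀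

-- Bounds on `k / D` from convergence

module _ (k D : ℕ) .{{_ : NonZero D}} (d : ℕ → Digit)
         (expansion : (+ k / D) HasExpansion d) where

  -- A gap of at least 1 / (10^m D) between x and all later partial sums
  -- would contradict convergence at this precision.
  prefix-close : ∀ m → let M = 10 ^ m * D in
    ∃[ j ] let T = prefix d (j + m); P = 10 ^ (j + m) in
      (T * D * M < (k * M + D) * P) × (k * P * M < (T * M + P) * D)
  prefix-close m =
      j
    , ∣/-/∣<1/⇒< T P k D M close
    , ∣/-/∣<1/⇒< k D T P M (subst (_<ℚ (+ 1 / M)) (∣p-q∣≡∣q-p∣ (+ T / P) (+ k / D)) close)
    where
    M : ℕ
    M = 10 ^ m * D
    instance
      M≢0 : NonZero M
      M≢0 = m*n≢0 (10 ^ m) D {{m^n≢0 10 m}}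
    convergence : ∃[ N ] (∀ i → N ≤ i → ∣ truncation d i - (+ k / D) ∣ <ℚ (+ 1 / M))
    convergence = expansion (+ 1 / M) (ℚ.normalize-pos 1 M)
    j T P : ℕ
    -- With the threshold itself as `j`, the index `j + m` is past both the threshold and `m`.
    j = proj₁ convergence
    T = prefix d (j + m)
    P = 10 ^ (j + m)
    instance
      P≢0 : NonZero P
      P≢0 = m^n≢0 10 (j + m)
    close : ∣ (+ T / P) - (+ k / D) ∣ <ℚ (+ 1 / M)
    close = subst (λ t → ∣ t - (+ k / D) ∣ <ℚ (+ 1 / M))
                  (truncation≡prefix/10^m d (j + m)) (proj₂ convergence (j + m) (m≤m+n j m))

  -- A violation between integers is by at least 1, hence a gap of at least `1 / M` between the
  -- fractions; by `prefix-lower` later truncations cannot close it.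
  prefix*D≤ : ∀ m → prefix d m * D ≤ 10 ^ m * k
  prefix*D≤ m = ≮⇒≥ λ gap → <-irrefl refl (begin-strict
    T * D * M                           <⟨ proj₁ (proj₂ (prefix-close m)) ⟩
    (k * M + D) * 10 ^ (j + m)          ≡⟨ cong ((k * M + D) *_) (^-distribˡ-+-* 10 j m) ⟩
    (k * M + D) * (10 ^ j * 10 ^ m)     ≡⟨ identity k (10 ^ j) (10 ^ m) D ⟩
    10 ^ j * suc (10 ^ m * k) * M       ≤⟨ *-monoˡ-≤ M (*-monoʳ-≤ (10 ^ j) gap) ⟩
    10 ^ j * (prefix d m * D) * M       ≡⟨ cong (_* M) (*-assoc (10 ^ j) (prefix d m) D) ⟨
    10 ^ j * prefix d m * D * M         ≤⟨ *-monoˡ-≤ M (*-monoˡ-≤ D (prefix-lower d j m)) ⟩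
    T * D * M                           ∎)
    where
    open ≤-Reasoning
    j T M : ℕ
    j = proj₁ (prefix-close m)
    T = prefix d (j + m)
    M = 10 ^ m * D
    identity : ∀ k J P D → (k * (P * D) + D) * (J * P) ≡ J * (1 + P * k) * (P * D)
    identity = solve-∀

  -- The mirror argument, with `prefix-upper`. Convergence alone gives no strict inequality: a tail
  -- of nines attains equality.
  ≤suc-prefix*D : ∀ m → 10 ^ m * k ≤ suc (prefix d m) * D
  ≤suc-prefix*D m = ≮⇒≥ λ gap → <-irrefl refl (begin-strict
    (T * M + 10 ^ (j + m)) * D                      ≡⟨ cong (λ t → (T * M + t) * D) (^-distribˡ-+-* 10 j m) ⟩
    (T * M + 10 ^ j * 10 ^ m) * D                   ≡⟨ identity₁ T (10 ^ j) (10 ^ m) D ⟩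
    (T * D + 10 ^ j) * M                            ≤⟨ *-monoˡ-≤ M (+-monoˡ-≤ (10 ^ j) (*-monoˡ-≤ D (≤-trans (n≤1+n T) (prefix-upper d j m)))) ⟩
    (10 ^ j * suc (prefix d m) * D + 10 ^ j) * M    ≡⟨ cong (_* M) (identity₂ (10 ^ j) (suc (prefix d m)) D) ⟩
    10 ^ j * suc (suc (prefix d m) * D) * M         ≤⟨ *-monoˡ-≤ M (*-monoʳ-≤ (10 ^ j) gap) ⟩
    10 ^ j * (10 ^ m * k) * M                       ≡⟨ cong (_* M) (identity₃ (10 ^ j) (10 ^ m) k) ⟩
    k * (10 ^ j * 10 ^ m) * M                       ≡⟨ cong (λ t → k * t * M) (^-distribˡ-+-* 10 j m) ⟨
    k * 10 ^ (j + m) * M                            <⟨ proj₂ (proj₂ (prefix-close m)) ⟩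
    (T * M + 10 ^ (j + m)) * D                      ∎)
    where
    open ≤-Reasoning
    j T M : ℕ
    j = proj₁ (prefix-close m)
    T = prefix d (j + m)
    M = 10 ^ m * D
    identity₁ : ∀ T J P D → (T * (P * D) + J * P) * D ≡ (T * D + J) * (P * D)
    identity₁ = solve-∀
    identity₂ : ∀ J S D → J * S * D + J ≡ J * (1 + S * D)
    identity₂ = solve-∀
    identity₃ : ∀ J P k → J * (P * k) ≡ k * (J * P)
    identity₃ = solve-∀

-- Divisibility, last digits and quotients

-- Since `10 * n` is `D + 1`, `n` inverts 10 modulo `D`; multiplying by `n` removes one factor 10 at
-- a time.
∣10^m*k⇒∣k : ∀ {D} n → suc D ≡ 10 * n → ∀ m k → D ∣ 10 ^ m * k → D ∣ k
∣10^m*k⇒∣k         n eq zero    k D∣ = subst (_ ∣_) (*-identityˡ k) D∣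
∣10^m*k⇒∣k {D} n eq (suc m) k D∣ = ∣10^m*k⇒∣k n eq m k
  (∣m+n∣m⇒∣n (subst (D ∣_) split (∣n⇒∣m*n n D∣)) (m∣m*n y))
  where
  y : ℕ
  y = 10 ^ m * k
  identity : ∀ n x k → n * (10 * x * k) ≡ 10 * n * (x * k)
  identity = solve-∀
  split : n * (10 ^ suc m * k) ≡ D * y + y
  split = trans (identity n (10 ^ m) k) (trans (cong (_* y) (sym eq)) (+-comm y (D * y)))

u-cong : ∀ x y → x % 10 ≡ y % 10 → u x ≡ u y
u-cong x y eq = toℕ-injective
  (trans (toℕ-fromℕ< (m%n<n x 10)) (trans eq (sym (toℕ-fromℕ< (m%n<n y 10)))))

toℕ-mod : ∀ {l} .{{_ : NonZero l}} (i : Fin l) → toℕ i mod l ≡ i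
toℕ-mod {l} i = toℕ-injective
  (trans (toℕ-fromℕ< (m%n<n (toℕ i) l)) (m<n⇒m%n≡m (toℕ<n i)))

u-prefix-suc : ∀ d m → u (prefix d (suc m)) ≡ d m
u-prefix-suc d m = trans (u-cong (T * 10 + e) e last-digit) (toℕ-mod (d m))
  where
  T e : ℕ
  T = prefix d m
  e = toℕ (d m)
  last-digit : (T * 10 + e) % 10 ≡ e % 10
  last-digit = trans (cong (_% 10) (+-comm (T * 10) e)) ([m+kn]%n≡m%n e T 10)

quotient-unique : ∀ x q r T D → x ≡ q * D + r → r < D → T * D ≤ x → x < suc T * D → q ≡ T
quotient-unique x q r T D eq r<D T*D≤x x<[1+T]*D = ≤-antisym
  (≤-pred (*-cancelʳ-< D q (suc T)
    (≤-<-trans (≤-trans (m≤m+n (q * D) r) (≤-reflexive (sym eq))) x<[1+T]*D)))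
  (≤-pred (*-cancelʳ-< D T (suc q)
    (≤-<-trans (≤-trans T*D≤x (≤-reflexive eq))
      (subst (q * D + r <_) (+-comm (q * D) D) (+-monoʳ-< (q * D) r<D)))))

-- Adding `10 * x` to `q` preserves the last digit and gives `r + q * suc D`, where `suc D` is a
-- multiple of 10.
u-quotient≡u-remainder : ∀ {D} n x q r → suc D ≡ 10 * n → 10 * x ≡ q * D + r → u q ≡ u r
u-quotient≡u-remainder {D} n x q r eq 10x≡ = u-cong q r (begin
  q % 10                    ≡⟨ [m+kn]%n≡m%n q x 10 ⟨
  (q + x * 10) % 10         ≡⟨ cong (λ t → (q + t) % 10) (trans (*-comm x 10) 10x≡) ⟩
  (q + (q * D + r)) % 10    ≡⟨ cong (_% 10) (identity₁ q D r) ⟩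
  (r + q * suc D) % 10      ≡⟨ cong (λ t → (r + q * t) % 10) eq ⟩
  (r + q * (10 * n)) % 10   ≡⟨ cong (λ t → (r + t) % 10) (identity₂ q n) ⟩
  (r + q * n * 10) % 10     ≡⟨ [m+kn]%n≡m%n r (q * n) 10 ⟩
  r % 10                    ∎)
  where
  open ≡-Reasoning
  identity₁ : ∀ q D r → q + (q * D + r) ≡ r + q * (1 + D)
  identity₁ = solve-∀
  identity₂ : ∀ q n → q * (10 * n) ≡ q * n * 10
  identity₂ = solve-∀

theorem2p5 : ∀ (k n : ℕ) .{{_ : NonZero n}} →
    1 ≤ k → k < 10 * n ∸ 1 →
    ∀ (l : ℕ) .{{_ : NonZero l}} (a : Fin l → Digit) →
    (_/_ (+ k) (10 * n ∸ 1) {{10n∸1≢0 n}}) HasExpansion (repeat a) →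
    IsPeriodLength (repeat a) l →
    ∀ (i : Fin l) (q r : ℕ) →
    10 ^ suc (toℕ i) * k ≡ q * (10 * n ∸ 1) + r →
    r < 10 * n ∸ 1 →
    (u q ≡ a i) × (u q ≡ u r)
theorem2p5 k@(suc _) n _ k<D l a expansion _ i q r eq r<D =
    (begin
      u q                       ≡⟨ cong u q≡T ⟩
      u (prefix (repeat a) m)   ≡⟨ u-prefix-suc (repeat a) (toℕ i) ⟩
      a (toℕ i mod l)           ≡⟨ cong a (toℕ-mod i) ⟩
      a i                       ∎)
  -- The exponent is positive, so a factor 10 splits off the dividend.
  , u-quotient≡u-remainder n (10 ^ toℕ i * k) q r 1+D≡10n
      (trans (sym (*-assoc 10 (10 ^ toℕ i) k)) eq)
  where
  open ≡-Reasoning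
  D m : ℕ
  D = 10 * n ∸ 1
  -- Indices start at zero, so `a i` is the last digit of the prefix of length `suc (toℕ i)`.
  m = suc (toℕ i)
  instance
    D≢0 : NonZero D
    D≢0 = 10n∸1≢0 n
  1+D≡10n : suc D ≡ 10 * n
  1+D≡10n = suc-pred (10 * n) {{m*n≢0 10 n}}
  T : ℕ
  T = prefix (repeat a) m
  -- Equality would make `D` divide `k`, impossible for `0 < k < D`.
  upper-strict : ¬ (10 ^ m * k ≡ suc T * D)
  upper-strict eq′ = <⇒≱ k<D (∣⇒≤ (∣10^m*k⇒∣k n 1+D≡10n m k (divides (suc T) eq′)))
  q≡T : q ≡ T
  q≡T = quotient-unique (10 ^ m * k) q r T D eq r<D
    (prefix*D≤ k D (repeat a) expansion m)
    (≤∧≢⇒< (≤suc-prefix*D k D (repeat a) expansion m) upper-strict)
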